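{- For every integer $k\ge 1$, every $2$-layer $k$-planar graph has pathwidth at most $k+1$.
   Context: All graphs are finite and simple (no loops or parallel edges). A topological $2$-layer graph is a bipartite graph $G=(U\,\dot\cup\,V,E)$, $E\subseteq U\times V$, drawn in the plane so that the vertices of $U$ and of $V$ are distinct points on two horizontal lines $L_u$ and $L_v$, respectively, and edges are $y$-monotone Jordan arcs; the drawing is assumed simple, i.e. adjacent edges do not cross and independent edges cross at most once. Denote the vertices by $u_1,\dots,u_p$ along $L_u$ and $v_1,\dots,v_q$ along $L_v$ in left-to-right order. (Thus edges $(u_i,v_x)$ and $(u_j,v_y)$ with $i<j$ cross if and only if $x>y$.) A topological $2$-layer graph is $k$-planar if each edge is crossed at most $k$ times. A bipartite graph is $2$-layer $k$-planar if it is isomorphic to the underlying abstract graph of some topological $2$-layer $k$-planar graph. A path decomposition of a graph $G=(W,E)$ is a path whose vertices are bags $B_1,\dots,B_r\subseteq W$ such that $W=\bigcup_i B_i$, every edge of $G$ has both endpoints in some bag, and for every vertex $w$ the bags containing $w$ induce a connected subpath. Its width is $\max_i(|B_i|-1)$, and the pathwidth of $G$ is the minimum width of a path decomposition of $G$. -}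

module Defs where

open import Data.Bool.Base using (Bool)
open import Data.Empty using (⊥)
open import Data.Fin.Base as Fin using (Fin; zero; suc; punchIn; punchOut; splitAt)
import Data.Fin.Properties as Fin
open import Data.Fin.Subset using (Subset; _∈_; ∣_∣) renaming (⊤ to full)
open import Data.Fin.Subset.Properties using (_∈?_; ∈⊤; anySubset?)
open import Data.List.Base using (List; allFin; cartesianProduct; filter; length; tabulate)
open import Data.List.Extrema.Nat using (max; max≤v⁺; xs≤max)
import Data.List.Relation.Unary.All.Properties as All
open import Data.Nat.Base using (ℕ; zero; suc; _+_; _∸_; _≤_; _<_; z≤n; s≤s)
import Data.Nat.Properties as ℕ
open import Data.Product.Base using (∃; ∃-syntax; Σ-syntax; _×_; _,_; proj₁; proj₂)
open import Data.Sum.Base using (_⊎_; inj₁; inj₂)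
open import Data.Vec.Base as Vec using (Vec; []; _∷_; lookup)
open import Data.Vec.Properties using (lookup∘tabulate)
open import Function.Base using (_∘_)
open import Function.Bundles using (_⇔_; _↔_; Inverse)
open import Level using (0ℓ)
open import Relation.Binary.Core using (Rel; REL)
open import Relation.Binary.Definitions
  using (Decidable; Symmetric; Irreflexive)
open import Relation.Binary.PropositionalEquality
  using (_≡_; _≢_; refl; sym; subst; cong; module ≡-Reasoning)
open import Relation.Nullary.Decidable
  using (Dec; yes; no; map′; ¬?; _×-dec_; _⊎-dec_; _→-dec_)
open import Relation.Nullary.Negation using (¬_; contradiction)
open import Relation.Unary as U using (Pred)

------------------------------------------------------------------------
-- Finite simple graphs

record Graph (n : ℕ) : Set₁ where
  field
    Adj    : Rel (Fin n) 0ℓ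
    adj?   : Decidable Adj
    symm   : Symmetric Adj
    irrefl : Irreflexive _≡_ Adj

open Graph public

record _≅_ {m n} (G : Graph m) (H : Graph n) : Set where
  field
    bijection : Fin m ↔ Fin n
    adjacency : ∀ u v → Adj G u v ⇔ Adj H (Inverse.to bijection u) (Inverse.to bijection v)

Bipartite : ∀ {n} → Graph n → Set
Bipartite {n} G =
  Σ[ side ∈ (Fin n → Bool) ] (∀ u v → Adj G u v → side u ≢ side v)

------------------------------------------------------------------------
-- Topological 2-layer graphs

-- A drawing is recorded by the left-to-right order of the vertices on the two
-- lines (u₁, …, u_p and v₁, …, v_q, as elements of Fin p and Fin q) and its
-- edges. In a simple drawing by y-monotone arcs this determines which edges
-- cross.
record TwoLayerGraph : Set₁ where
  field
    p q   : ℕ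
    Edge  : REL (Fin p) (Fin q) 0ℓ
    edge? : Decidable Edge

  edges : List (Fin p × Fin q)
  edges = filter (λ (i , x) → edge? i x) (cartesianProduct (allFin p) (allFin q))

  Cross : Rel (Fin p × Fin q) 0ℓ
  Cross (i , x) (j , y) = (i Fin.< j × y Fin.< x) ⊎ (j Fin.< i × x Fin.< y)

  cross? : Decidable Cross
  cross? (i , x) (j , y) =
    (i Fin.<? j ×-dec y Fin.<? x) ⊎-dec (j Fin.<? i ×-dec x Fin.<? y)

  crossings : Fin p × Fin q → ℕ
  crossings e = length (filter (cross? e) edges)

  Planar : ℕ → Set
  Planar k = ∀ i x → Edge i x → crossings (i , x) ≤ k

  Joined : Rel (Fin p ⊎ Fin q) 0ℓ
  Joined (inj₁ i) (inj₂ x) = Edge i x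
  Joined (inj₂ x) (inj₁ i) = Edge i x
  Joined (inj₁ _) (inj₁ _) = ⊥
  Joined (inj₂ _) (inj₂ _) = ⊥

  joined? : Decidable Joined
  joined? (inj₁ i) (inj₂ x) = edge? i x
  joined? (inj₂ x) (inj₁ i) = edge? i x
  joined? (inj₁ _) (inj₁ _) = no λ ()
  joined? (inj₂ _) (inj₂ _) = no λ ()

  joined-sym : Symmetric Joined
  joined-sym {inj₁ _} {inj₂ _} e = e
  joined-sym {inj₂ _} {inj₁ _} e = e

  joined-irrefl : Irreflexive _≡_ Joined
  joined-irrefl {inj₁ _} refl ()
  joined-irrefl {inj₂ _} refl ()

  underlying : Graph (p + q)
  underlying = record
    { Adj    = λ a b → Joined (splitAt p a) (splitAt p b)
    ; adj?   = λ a b → joined? (splitAt p a) (splitAt p b)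
    ; symm   = λ {a} {b} → joined-sym {splitAt p a} {splitAt p b}
    ; irrefl = λ {a} {b} a≡b → joined-irrefl {splitAt p a} {splitAt p b} (cong (splitAt p) a≡b)
    }

TwoLayerPlanar : ∀ {n} → ℕ → Graph n → Set₁
TwoLayerPlanar k G =
  Bipartite G ×
  (Σ[ D ∈ TwoLayerGraph ] TwoLayerGraph.Planar D k × G ≅ TwoLayerGraph.underlying D)

------------------------------------------------------------------------
-- Path decompositions

record IsPathDecomposition {n r} (G : Graph n) (bag : Fin r → Subset n) : Set where
  field
    vertices  : ∀ w → ∃[ i ] w ∈ bag i
    edges     : ∀ u v → Adj G u v → ∃[ i ] (u ∈ bag i × v ∈ bag i)
    -- Connected subgraphs of a path are its intervals.
    connected : ∀ w i j l → i Fin.≤ j → j Fin.≤ l → w ∈ bag i → w ∈ bag l → w ∈ bag j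

record PathDecomposition {n} (G : Graph n) : Set where
  field
    len                 : ℕ
    bag                 : Fin (suc len) → Subset n
    isPathDecomposition : IsPathDecomposition G bag

  open IsPathDecomposition isPathDecomposition public

  -- The truncation in ∸ and the base value 0 only matter if all bags are
  -- empty, that is, if G has no vertices; the width is then 0.
  width : ℕ
  width = max 0 (tabulate λ i → ∣ bag i ∣ ∸ 1)

  width≤⁺ : ∀ {w} → (∀ i → ∣ bag i ∣ ∸ 1 ≤ w) → width ≤ w
  width≤⁺ h = max≤v⁺ {xs = tabulate λ i → ∣ bag i ∣ ∸ 1} z≤n (All.tabulate⁺ h)

  width≤⁻ : ∀ {w} → width ≤ w → ∀ i → ∣ bag i ∣ ∸ 1 ≤ w
  width≤⁻ h i =
    ℕ.≤-trans (All.tabulate⁻ {f = λ i → ∣ bag i ∣ ∸ 1} (xs≤max 0 _) i) h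

open PathDecomposition public using (width)

IsPathwidth : ∀ {n} → Graph n → ℕ → Set
IsPathwidth G w =
  (Σ[ D ∈ PathDecomposition G ] width D ≡ w) × (∀ (D : PathDecomposition G) → w ≤ width D)

------------------------------------------------------------------------
-- Existence of the minimum width. A decomposition with more than n + 1 bags
-- has a bag that is nobody's first bag, and that bag can be deleted; so only
-- finitely many decompositions need to be searched.

private

  least : ∀ {P : Pred ℕ 0ℓ} → U.Decidable P → ∀ n → P n → ∃[ m ] (P m × (∀ n → P n → m ≤ n))
  least P? zero p = 0 , p , λ _ _ → z≤n
  least P? (suc n) p with P? 0
  ... | yes p₀ = 0 , p₀ , λ _ _ → z≤n
  ... | no ¬p₀ =
    let m , pₘ , min = least (P? ∘ suc) n p
    in suc m , pₘ , λ { zero p₀ → contradiction p₀ ¬p₀ ; (suc n) pₙ → s≤s (min n pₙ) }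

  leastFin : ∀ {r} {P : Pred (Fin r) 0ℓ} → U.Decidable P → ∀ i → P i →
             ∃[ i ] (P i × (∀ j → P j → i Fin.≤ j))
  leastFin {suc r} P? i p with P? zero
  ... | yes p₀ = zero , p₀ , λ _ _ → z≤n
  leastFin {suc r} P? zero    p | no ¬p₀ = contradiction p ¬p₀
  leastFin {suc r} P? (suc i) p | no ¬p₀ =
    let m , pₘ , min = leastFin (P? ∘ suc) i p
    in suc m , pₘ , λ { zero p₀ → contradiction p₀ ¬p₀ ; (suc j) pⱼ → s≤s (min j pⱼ) }

  missed : ∀ {m r} → m < r → (f : Fin m → Fin r) → ∃[ i ] (∀ w → i ≢ f w)
  missed {m} {r} m<r f with Fin.any? (λ i → Fin.all? (λ w → miss? i w))
    where
    miss? : ∀ i w → Dec (i ≢ f w)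
    miss? i w = ¬? (i Fin.≟ f w)
  ... | yes found = found
  ... | no  none  = contradiction (Fin.pigeonhole m<r preimage) noCollision
    where
    hit : ∀ i → ∃[ w ] i ≡ f w
    hit i with Fin.any? (λ w → i Fin.≟ f w)
    ... | yes h = h
    ... | no ¬h = contradiction (i , λ w eq → ¬h (w , eq)) none
    preimage : Fin r → Fin m
    preimage i = proj₁ (hit i)
    noCollision : ¬ (∃[ i ] ∃[ j ] (i Fin.< j × preimage i ≡ preimage j))
    noCollision (i , j , i<j , eq) = Fin.<⇒≢ i<j (begin
      i               ≡⟨ proj₂ (hit i) ⟩
      f (preimage i)  ≡⟨ cong f eq ⟩
      f (preimage j)  ≡⟨ proj₂ (hit j) ⟨
      j               ∎)
      where open ≡-Reasoning

  anyVec? : ∀ {n r} {P : Pred (Vec (Subset n) r) 0ℓ} → U.Decidable P → Dec (∃ P)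
  anyVec? {r = zero}  P? = map′ (λ p → [] , p) (λ { ([] , p) → p }) (P? [])
  anyVec? {r = suc r} P? =
    map′ (λ (B , Bs , p) → B ∷ Bs , p) (λ { (B ∷ Bs , p) → B , Bs , p })
         (anySubset? (λ B → anyVec? (λ Bs → P? (B ∷ Bs))))

  module _ {n} (G : Graph n) where

    Within : ∀ {r} → ℕ → (Fin r → Subset n) → Set
    Within w bag = IsPathDecomposition G bag × (∀ i → ∣ bag i ∣ ∸ 1 ≤ w)

    isPathDecomposition? : ∀ {r} (bag : Fin r → Subset n) → Dec (IsPathDecomposition G bag)
    isPathDecomposition? bag =
      map′ (λ (v , e , c) → record { vertices = v ; edges = e ; connected = c })
           (λ D → let open IsPathDecomposition D in vertices , edges , connected)
           (Fin.all? (λ w → Fin.any? λ i → w ∈? bag i)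
            ×-dec Fin.all? (λ u → Fin.all? λ v →
              adj? G u v →-dec Fin.any? λ i → u ∈? bag i ×-dec v ∈? bag i)
            ×-dec Fin.all? (λ w → Fin.all? λ i → Fin.all? λ j → Fin.all? λ l →
              i Fin.≤? j →-dec j Fin.≤? l →-dec
              w ∈? bag i →-dec w ∈? bag l →-dec w ∈? bag j))

    within? : ∀ {r} w (bag : Fin r → Subset n) → Dec (Within w bag)
    within? w bag = isPathDecomposition? bag ×-dec Fin.all? (λ i → _ ℕ.≤? w)

    relabel : ∀ {r w} {bag bag′ : Fin r → Subset n} → (∀ i → bag i ≡ bag′ i) →
              Within w bag → Within w bag′
    relabel {w = w} {bag} {bag′} eq (D , h) =
      record
        { vertices  = λ a → let i , m = vertices a in i , to m
        ; edges     = λ u v e → let i , m , m′ = edges u v e in i , to m , to m′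
        ; connected = λ a i j l i≤j j≤l m m′ → to (connected a i j l i≤j j≤l (from m) (from m′))
        } , λ i → subst (λ B → ∣ B ∣ ∸ 1 ≤ w) (eq i) (h i)
      where
      open IsPathDecomposition D
      to : ∀ {a i} → a ∈ bag i → a ∈ bag′ i
      to {a} {i} = subst (a ∈_) (eq i)
      from : ∀ {a i} → a ∈ bag′ i → a ∈ bag i
      from {a} {i} = subst (a ∈_) (sym (eq i))

    delete : ∀ {r w} {bag : Fin (suc r) → Subset n} → n < suc r → Within w bag →
             ∃[ i ] Within w (bag ∘ punchIn i)
    delete {r} {w} {bag} n<r (D , h) = k , record
        { vertices  = λ a → moved a , keep a (firstIn a)
        ; edges     = edge
        ; connected = λ a i j l i≤j j≤l →
            connected a _ _ _ (Fin.punchIn-mono-≤ k i j i≤j) (Fin.punchIn-mono-≤ k j l j≤l)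
        } , λ i → h (punchIn k i)
      where
      open IsPathDecomposition D
      first : ∀ a → ∃[ i ] (a ∈ bag i × (∀ j → a ∈ bag j → i Fin.≤ j))
      first a = let i , m = vertices a in leastFin (λ i → a ∈? bag i) i m
      pos : Fin n → Fin (suc r)
      pos a = proj₁ (first a)
      firstIn : ∀ a → a ∈ bag (pos a)
      firstIn a = proj₁ (proj₂ (first a))
      firstMin : ∀ a j → a ∈ bag j → pos a Fin.≤ j
      firstMin a = proj₂ (proj₂ (first a))
      k : Fin (suc r)
      k = proj₁ (missed n<r pos)
      k≢ : ∀ a → k ≢ pos a
      k≢ = proj₂ (missed n<r pos)
      moved : Fin n → Fin r
      moved a = punchOut (k≢ a)
      keep : ∀ a {b} → b ∈ bag (pos a) → b ∈ bag (punchIn k (moved a))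
      keep a {b} = subst (λ i → b ∈ bag i) (sym (Fin.punchIn-punchOut (k≢ a)))
      edge : ∀ u v → Adj G u v → ∃[ i ] (u ∈ bag (punchIn k i) × v ∈ bag (punchIn k i))
      edge u v e with edges u v e | Fin.≤-total (pos u) (pos v)
      ... | l , mᵤ , mᵥ | inj₁ u≤v = moved v ,
        keep v (connected u _ _ l u≤v (firstMin v l mᵥ) (firstIn u) mᵤ) , keep v (firstIn v)
      ... | l , mᵤ , mᵥ | inj₂ v≤u = moved u ,
        keep u (firstIn u) , keep u (connected v _ _ l v≤u (firstMin u l mᵤ) (firstIn v) mᵥ)

    shorten : ∀ r {w} {bag : Fin (suc r) → Subset n} → Within w bag →
              Σ[ s ∈ Fin (suc n) ] Σ[ bag′ ∈ (Fin (suc (Fin.toℕ s)) → Subset n) ] Within w bag′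
    shorten zero    {bag = bag} D = zero , bag , D
    shorten (suc r) {w} {bag} D with n ℕ.<? suc r
    ... | yes n<r = let _ , D′ = delete (ℕ.m≤n⇒m≤1+n n<r) D in shorten r D′
    ... | no  n≮r = Fin.fromℕ< r<n ,
      subst (λ t → Σ[ b ∈ (Fin (suc t) → Subset n) ] Within w b)
            (sym (Fin.toℕ-fromℕ< r<n)) (bag , D)
      where
      r<n : suc r < suc n
      r<n = s≤s (ℕ.≮⇒≥ n≮r)

    WidthAtMost : Pred ℕ 0ℓ
    WidthAtMost w = Σ[ D ∈ PathDecomposition G ] width D ≤ w

    widthAtMost? : U.Decidable WidthAtMost
    widthAtMost? w =
      map′ found search
        (Fin.any? {n = suc n} λ s →
          anyVec? {r = suc (Fin.toℕ s)} λ Bs → within? w (lookup Bs))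
      where
      Found : Set
      Found = Σ[ s ∈ Fin (suc n) ] Σ[ Bs ∈ Vec (Subset n) (suc (Fin.toℕ s)) ] Within w (lookup Bs)
      found : Found → WidthAtMost w
      found (s , Bs , D , h) =
        let D′ = record { len = Fin.toℕ s ; bag = lookup Bs ; isPathDecomposition = D }
        in D′ , PathDecomposition.width≤⁺ D′ h
      search : WidthAtMost w → Found
      search (D , h) =
        let s , bag , D′ = shorten (len D) (isPathDecomposition D , PathDecomposition.width≤⁻ D h)
        in s , Vec.tabulate bag , relabel (λ i → sym (lookup∘tabulate bag i)) D′
        where open PathDecomposition

    trivial : PathDecomposition G
    trivial = record
      { len = 0
      ; bag = λ _ → full
      ; isPathDecomposition = record
        { vertices  = λ _ → zero , ∈⊤
        ; edges     = λ _ _ _ → zero , ∈⊤ , ∈⊤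
        ; connected = λ _ _ _ _ _ _ _ _ → ∈⊤
        }
      }

abstract
  ∃-pathwidth : ∀ {n} (G : Graph n) → ∃ (IsPathwidth G)
  ∃-pathwidth G =
    let w , (D , D≤w) , min = least (widthAtMost? G) _ (trivial G , ℕ.≤-refl)
        bound = λ D → min (width D) (D , ℕ.≤-refl)
    in w , (D , ℕ.≤-antisym D≤w (bound D)) , bound

pathwidth : ∀ {n} → Graph n → ℕ
pathwidth G = proj₁ (∃-pathwidth G)

isPathwidth : ∀ {n} (G : Graph n) → IsPathwidth G (pathwidth G)
isPathwidth G = proj₂ (∃-pathwidth G)

{-# OPTIONS --safe #-}

-- Sweep over the edges (u_i , v_x) in lexicographic order and keep a vertex
-- alive from its first edge to its last. While (u_i , v_x) is processed, u_i is
-- the only live vertex of the first layer. A live v_y with y < x still has an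
-- edge (u_j , v_y) to come, so j > i; a live v_y with y > x has had an edge
-- (u_j , v_y) already, so j < i. Either edge crosses (u_i , v_x), and different
-- y give different edges. Hence at most 2 + k vertices are live.

module Submission where

open import Defs
open import Data.Fin.Base as Fin using (Fin; combine; fromℕ<; join; splitAt; toℕ)
import Data.Fin.Properties as Fin
open import Data.Fin.Subset using (Subset; _∈_; _∪_; ∣_∣; ⁅_⁆; ⋃; inside; outside)
open import Data.Fin.Subset.Properties using (p⊆q⇒∣p∣≤∣q∣; ∣⁅x⁆∣≡1; ∣⊥∣≡0; x∈⁅x⁆; x∈p∪q⁺)
open import Data.List.Base using (List; []; _∷_; [_]; filter; length; map)
open import Data.List.Membership.Propositional using () renaming (_∈_ to _∈ₗ_)
open import Data.List.Membership.Propositional.Properties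
  using (∈-allFin; ∈-cartesianProduct⁺; ∈-filter⁺; ∈-map⁺)
open import Data.List.Properties using (length-map)
open import Data.List.Relation.Unary.Any using (here; there)
open import Data.Nat.Base using (ℕ; zero; suc; _+_; _*_; _∸_; _≤_; _<_; z≤n; s≤s)
import Data.Nat.Properties as ℕ
open import Data.Product.Base using (∃-syntax; _×_; _,_; proj₂)
open import Data.Sum.Base using (_⊎_; inj₁; inj₂)
open import Data.Sum.Properties using (≡-dec)
open import Data.Vec.Base using ([]; _∷_; tabulate)
open import Data.Vec.Properties using (lookup∘tabulate; lookup⇒[]=; []=⇒lookup)
open import Function.Base using (_∘_)
open import Function.Bundles using (Equivalence; Inverse)
open import Level using (0ℓ)
open import Relation.Binary.Definitions using (tri<; tri≈; tri>)
open import Relation.Binary.PropositionalEquality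
  using (_≡_; refl; sym; trans; cong; subst; subst₂)
open import Relation.Nullary.Decidable
  using (Dec; yes; no; does; dec-true; ¬?; _×-dec_; _⊎-dec_)
open import Relation.Nullary.Negation using (¬_; contradiction)
open import Relation.Unary as U using (Pred)

-- Finite subsets and their cardinalities.

module _ {n} {P : Pred (Fin n) 0ℓ} (P? : U.Decidable P) where

  comprehension : Subset n
  comprehension = tabulate (does ∘ P?)

  ∈-comprehension⁺ : ∀ {w} → P w → w ∈ comprehension
  ∈-comprehension⁺ {w} Pw =
    lookup⇒[]= w _ (trans (lookup∘tabulate (does ∘ P?) w) (dec-true (P? w) Pw))

  ∈-comprehension⁻ : ∀ {w} → w ∈ comprehension → P w
  ∈-comprehension⁻ {w} w∈
    with P? w | trans (sym (lookup∘tabulate (does ∘ P?) w)) ([]=⇒lookup w∈)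
  ... | yes Pw | _  = Pw
  ... | no _   | ()

∣p∪q∣≤∣p∣+∣q∣ : ∀ {n} (p q : Subset n) → ∣ p ∪ q ∣ ≤ ∣ p ∣ + ∣ q ∣
∣p∪q∣≤∣p∣+∣q∣ []            []            = z≤n
∣p∪q∣≤∣p∣+∣q∣ (outside ∷ p) (outside ∷ q) = ∣p∪q∣≤∣p∣+∣q∣ p q
∣p∪q∣≤∣p∣+∣q∣ (outside ∷ p) (inside  ∷ q) =
  ℕ.≤-trans (s≤s (∣p∪q∣≤∣p∣+∣q∣ p q)) (ℕ.≤-reflexive (sym (ℕ.+-suc ∣ p ∣ ∣ q ∣)))
∣p∪q∣≤∣p∣+∣q∣ (inside  ∷ p) (outside ∷ q) = s≤s (∣p∪q∣≤∣p∣+∣q∣ p q)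
∣p∪q∣≤∣p∣+∣q∣ (inside  ∷ p) (inside  ∷ q) =
  s≤s (ℕ.≤-trans (∣p∪q∣≤∣p∣+∣q∣ p q) (ℕ.+-monoʳ-≤ ∣ p ∣ (ℕ.n≤1+n ∣ q ∣)))

-- Repetitions in `xs` do no harm: `p` lies in the union of the singletons of its entries, and
-- cardinality is subadditive under union.
∣p∣≤length : ∀ {n} {p : Subset n} (xs : List (Fin n)) →
             (∀ {w} → w ∈ p → w ∈ₗ xs) → ∣ p ∣ ≤ length xs
∣p∣≤length {n} xs covers =
  ℕ.≤-trans (p⊆q⇒∣p∣≤∣q∣ (∈-⋃ ∘ covers)) (∣⋃∣≤length xs)
  where
  ∈-⋃ : ∀ {w xs} → w ∈ₗ xs → w ∈ ⋃ (map ⁅_⁆ xs)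
  ∈-⋃ (here refl) = x∈p∪q⁺ (inj₁ (x∈⁅x⁆ _))
  ∈-⋃ (there w∈)  = x∈p∪q⁺ (inj₂ (∈-⋃ w∈))

  ∣⋃∣≤length : ∀ xs → ∣ ⋃ (map ⁅_⁆ xs) ∣ ≤ length xs
  ∣⋃∣≤length []       = ℕ.≤-reflexive (∣⊥∣≡0 n)
  ∣⋃∣≤length (x ∷ xs) = ℕ.≤-trans (∣p∪q∣≤∣p∣+∣q∣ ⁅ x ⁆ _)
    (ℕ.+-mono-≤ (ℕ.≤-reflexive (∣⁅x⁆∣≡1 x)) (∣⋃∣≤length xs))

-- The code `combine i x` has the value `n * toℕ i + toℕ x` with `toℕ x < n`, so codes compare as
-- pairs do lexicographically.
combine-≤⁻ : ∀ {m n} {i j : Fin m} {x y : Fin n} → combine i x Fin.≤ combine j y →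
             i Fin.< j ⊎ (i ≡ j × x Fin.≤ y)
combine-≤⁻ {n = n} {i} {j} {x} {y} h with Fin.<-cmp i j
... | tri< i<j _    _   = inj₁ i<j
... | tri≈ _   refl _   = inj₂ (refl , ℕ.+-cancelˡ-≤ (n * toℕ i) _ _
  (subst₂ _≤_ (Fin.toℕ-combine i x) (Fin.toℕ-combine i y) h))
... | tri> _   _    j<i = contradiction h (ℕ.<⇒≱ (Fin.combine-monoˡ-< y x j<i))

module Sweep {n k} {G : Graph n} (D : TwoLayerGraph) (planar : TwoLayerGraph.Planar D k)
             (iso : G ≅ TwoLayerGraph.underlying D) where

  open TwoLayerGraph D
  open _≅_ iso

  place : Fin n → Fin p ⊎ Fin q
  place w = splitAt p (Inverse.to bijection w)

  vertex : Fin p ⊎ Fin q → Fin n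
  vertex a = Inverse.from bijection (join p q a)

  vertex-place : ∀ w → vertex (place w) ≡ w
  vertex-place w = trans (cong (Inverse.from bijection) (Fin.join-splitAt p q _))
                         (Inverse.strictlyInverseʳ bijection w)

  End : Fin p ⊎ Fin q → Fin p → Fin q → Set
  End a i x = a ≡ inj₁ i ⊎ a ≡ inj₂ x

  Joined⇒End : ∀ a b → Joined a b → ∃[ i ] ∃[ x ] (Edge i x × End a i x × End b i x)
  Joined⇒End (inj₁ i) (inj₂ x) e = i , x , e , inj₁ refl , inj₂ refl
  Joined⇒End (inj₂ x) (inj₁ i) e = i , x , e , inj₂ refl , inj₁ refl

  -- Moments of the sweep and live vertices.

  Isolated : Fin n → Set
  Isolated w = ¬ (∃[ i ] ∃[ x ] (Edge i x × End (place w) i x))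

  time : Fin p → Fin q → ℕ
  time i x = toℕ (combine i x)

  -- Isolated vertices get a moment of their own after all edges.
  Touched : ℕ → Fin n → Set
  Touched t w = (∃[ i ] ∃[ x ] (Edge i x × End (place w) i x × t ≡ time i x))
              ⊎ (Isolated w × t ≡ p * q + toℕ w)

  end? : ∀ w i x → Dec (End (place w) i x)
  end? w i x = ≡-dec Fin._≟_ Fin._≟_ (place w) (inj₁ i)
         ⊎-dec ≡-dec Fin._≟_ Fin._≟_ (place w) (inj₂ x)

  incident? : ∀ w → Dec (∃[ i ] ∃[ x ] (Edge i x × End (place w) i x))
  incident? w = Fin.any? λ i → Fin.any? λ x → edge? i x ×-dec end? w i x

  touched? : ∀ t w → Dec (Touched t w)
  touched? t w =
    Fin.any? (λ i → Fin.any? λ x → edge? i x ×-dec end? w i x ×-dec t ℕ.≟ time i x)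
    ⊎-dec (¬? (incident? w) ×-dec t ℕ.≟ p * q + toℕ w)

  -- Every touch happens strictly before this moment. The extra bag at `last` is empty and supplies
  -- the one bag a decomposition must have even when `n` is 0.
  last : ℕ
  last = p * q + n

  time<p*q : ∀ i x → time i x < p * q
  time<p*q i x = Fin.toℕ<n (combine i x)

  touched≤last : ∀ {t w} → Touched t w → t ≤ last
  touched≤last (inj₁ (i , x , _ , _ , refl)) =
    ℕ.≤-trans (ℕ.<⇒≤ (time<p*q i x)) (ℕ.m≤m+n (p * q) n)
  touched≤last {w = w} (inj₂ (_ , refl)) = ℕ.+-monoʳ-≤ (p * q) (ℕ.<⇒≤ (Fin.toℕ<n w))

  -- The interval from first to last touch, expressed by a touch on either side of `t`. Both
  -- searches are bounded, in the form that `anyUpTo?` decides; by `touched≤last` the bound `last`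
  -- excludes no touch.
  Live : ℕ → Fin n → Set
  Live t w = (∃[ s ] (s < suc t × Touched s w)) × (∃[ s ] (s < suc last × t ≤ s × Touched s w))

  live? : ∀ t w → Dec (Live t w)
  live? t w = ℕ.anyUpTo? (λ s → touched? s w) (suc t)
        ×-dec ℕ.anyUpTo? (λ s → t ℕ.≤? s ×-dec touched? s w) (suc last)

  live : ℕ → Subset n
  live t = comprehension (live? t)

  touched⇒live : ∀ {t w} → Touched t w → Live t w
  touched⇒live c = (_ , ℕ.≤-refl , c) , (_ , s≤s (touched≤last c) , ℕ.≤-refl , c)

  -- Live vertices at a single moment.

  neighbourhood : Fin p → Fin q → List (Fin n)
  neighbourhood i x = vertex (inj₁ i) ∷ vertex (inj₂ x)
    ∷ map (λ (_ , y) → vertex (inj₂ y)) (filter (cross? (i , x)) edges)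

  ∣neighbourhood∣≤2+k : ∀ {i x} → Edge i x → length (neighbourhood i x) ≤ 2 + k
  ∣neighbourhood∣≤2+k {i} {x} e = s≤s (s≤s
    (ℕ.≤-trans (ℕ.≤-reflexive (length-map _ (filter (cross? (i , x)) edges))) (planar i x e)))

  edge∈edges : ∀ {i x} → Edge i x → (i , x) ∈ₗ edges
  edge∈edges {i} {x} =
    ∈-filter⁺ (λ (i , x) → edge? i x) (∈-cartesianProduct⁺ (∈-allFin i) (∈-allFin x))

  crossing⇒∈ : ∀ {i x j y} → Edge j y → Cross (i , x) (j , y) →
               vertex (inj₂ y) ∈ₗ neighbourhood i x
  crossing⇒∈ {i} {x} e c = there (there (∈-map⁺ _ (∈-filter⁺ (cross? (i , x)) (edge∈edges e) c)))

  -- On the first line `j = j′`, so `i` is squeezed between equal indices. On the second line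
  -- `y = y′`; a tie `i = j′` when `y < x`, or `j = i` when `x < y`, would contradict the
  -- lexicographic order, so the crossing is strict in both coordinates.
  between⇒∈ : ∀ {i x j y j′ y′} a → Edge j y → Edge j′ y′ → End a j y → End a j′ y′ →
              time j y ≤ time i x → time i x ≤ time j′ y′ → vertex a ∈ₗ neighbourhood i x
  between⇒∈ {i} {x} {j} _ e e′ (inj₁ refl) (inj₁ refl) before after
    with combine-≤⁻ {i = j} before | combine-≤⁻ {i = i} after
  ... | inj₂ (refl , _) | _               = here refl
  ... | inj₁ _          | inj₂ (refl , _) = here refl
  ... | inj₁ j<i        | inj₁ i<j        = contradiction i<j (ℕ.<-asym j<i)
  between⇒∈ {i} {x} {j} {y} _ e e′ (inj₂ refl) (inj₂ refl) before after
    with Fin.<-cmp y x | combine-≤⁻ {i = j} before | combine-≤⁻ {i = i} after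
  ... | tri≈ _ refl _ | _                | _                = there (here refl)
  ... | tri< y<x _ _  | _                | inj₁ i<j′        = crossing⇒∈ e′ (inj₁ (i<j′ , y<x))
  ... | tri< y<x _ _  | _                | inj₂ (_ , x≤y)   = contradiction x≤y (ℕ.<⇒≱ y<x)
  ... | tri> _ _ x<y  | inj₁ j<i         | _                = crossing⇒∈ e (inj₂ (j<i , x<y))
  ... | tri> _ _ x<y  | inj₂ (_ , y≤x)   | _                = contradiction y≤x (ℕ.<⇒≱ x<y)

  live-edge : ∀ {i x w} → Live (time i x) w → w ∈ₗ neighbourhood i x
  live-edge {i} {x} {w}
    ((_ , s≤s before , inj₁ (_ , _ , e , a , refl)) , (_ , _ , after , inj₁ (_ , _ , e′ , a′ , refl))) =
    subst (_∈ₗ neighbourhood i x) (vertex-place w) (between⇒∈ (place w) e e′ a a′ before after)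
  live-edge ((_ , _ , inj₁ (i , x , e , a , _)) , (_ , _ , _ , inj₂ (isolated , _))) =
    contradiction (i , x , e , a) isolated
  -- Moments of isolated vertices start at `p * q`, after every edge.
  live-edge {i} {x} ((_ , s≤s before , inj₂ (_ , refl)) , _) =
    contradiction (ℕ.≤-trans (ℕ.m≤m+n (p * q) _) before) (ℕ.<⇒≱ (time<p*q i x))

  -- No edge is processed from `p * q` on, so the later touch of `w` shows it to be isolated; its
  -- only moment is then squeezed onto that of `v`.
  live-isolated : ∀ {v w} → Live (p * q + toℕ v) w → w ≡ v
  live-isolated ((_ , s≤s before , inj₂ (_ , refl)) , (_ , _ , after , inj₂ (_ , refl))) =
    Fin.toℕ-injective (ℕ.≤-antisym (ℕ.+-cancelˡ-≤ (p * q) _ _ before)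
                                   (ℕ.+-cancelˡ-≤ (p * q) _ _ after))
  live-isolated ((_ , _ , inj₁ (i , x , e , a , _)) , (_ , _ , _ , inj₂ (isolated , _))) =
    contradiction (i , x , e , a) isolated
  live-isolated (_ , (_ , _ , after , inj₁ (i , x , _ , _ , refl))) =
    contradiction (ℕ.≤-trans (ℕ.m≤m+n (p * q) _) after) (ℕ.<⇒≱ (time<p*q i x))

  -- The earlier touch of `w` cannot be at `suc t` itself, so it is at `t` or before: a vertex
  -- enters the bags only at a moment that touches it.
  live-untouched : ∀ {t w} → ¬ Touched (suc t) w → Live (suc t) w → Live t w
  live-untouched ¬c ((s , s<2+t , c) , (s′ , s′≤last , t<s′ , c′)) with ℕ.m≤n⇒m<n∨m≡n s<2+t
  ... | inj₁ (s≤s s≤t) = (s , s≤t , c) , (s′ , s′≤last , ℕ.<⇒≤ t<s′ , c′)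
  ... | inj₂ refl      = contradiction c ¬c

  -- `time` numbers all pairs `(i , x)`, edges or not, so some moments touch no vertex. Induction on
  -- `t` carries the bound over from the preceding moment to these.
  ∣live∣≤2+k : ∀ t → ∣ live t ∣ ≤ 2 + k
  ∣live∣≤2+k t with Fin.any? (touched? t)
  ... | yes (_ , inj₁ (i , x , e , _ , refl)) = ℕ.≤-trans
    (∣p∣≤length (neighbourhood i x) (live-edge ∘ ∈-comprehension⁻ (live? t)))
    (∣neighbourhood∣≤2+k e)
  ... | yes (w , inj₂ (_ , refl)) = ℕ.≤-trans
    (∣p∣≤length [ w ] (here ∘ live-isolated ∘ ∈-comprehension⁻ (live? t)))
    (s≤s z≤n)
  ∣live∣≤2+k zero | no ¬c = ℕ.≤-trans (∣p∣≤length [] (nobody ∘ ∈-comprehension⁻ (live? 0))) z≤n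
    where
    nobody : ∀ {w} → Live 0 w → w ∈ₗ []
    -- The earlier touch can only be at moment 0.
    nobody ((_ , s≤s z≤n , c) , _) = contradiction (_ , c) ¬c
  ∣live∣≤2+k (suc t) | no ¬c = ℕ.≤-trans
    (p⊆q⇒∣p∣≤∣q∣ (∈-comprehension⁺ (live? t) ∘ live-untouched (λ c → ¬c (_ , c))
                  ∘ ∈-comprehension⁻ (live? (suc t))))
    (∣live∣≤2+k t)

  -- The path decomposition and its width.

  bag : Fin (suc last) → Subset n
  bag i = live (toℕ i)

  moment : ∀ {t w} → Touched t w → Fin (suc last)
  moment c = fromℕ< (s≤s (touched≤last c))

  touched⇒∈bag : ∀ {t v w} (c : Touched t v) → Touched t w → w ∈ bag (moment c)
  touched⇒∈bag {w = w} c c′ = subst (λ s → w ∈ live s)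
    (sym (Fin.toℕ-fromℕ< (s≤s (touched≤last c)))) (∈-comprehension⁺ (live? _) (touched⇒live c′))

  touchedSometime : ∀ w → ∃[ t ] Touched t w
  touchedSometime w with incident? w
  ... | yes (i , x , e , a) = time i x , inj₁ (i , x , e , a , refl)
  ... | no isolated         = _ , inj₂ (isolated , refl)

  decomposition : PathDecomposition G
  decomposition = record
    { len = last
    ; bag = bag
    ; isPathDecomposition = record
      { vertices  = λ w → let _ , c = touchedSometime w in moment c , touched⇒∈bag c c
      ; edges     = λ u v uv →
          -- Both ends of an edge are touched at its time and so share that bag.
          let i , x , e , a , b =
                Joined⇒End (place u) (place v) (Equivalence.to (adjacency u v) uv)
              c = inj₁ (i , x , e , a , refl)
          in moment c , touched⇒∈bag c c , touched⇒∈bag c (inj₁ (i , x , e , b , refl))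
      ; connected = λ w i j l i≤j j≤l w∈i w∈l →
          -- The touch up to `i` also precedes `j`, and the touch from `l` on also follows `j`.
          let (s , s≤i , c) , _ = ∈-comprehension⁻ (live? (toℕ i)) w∈i
              _ , (s′ , s′≤last , l≤s′ , c′) = ∈-comprehension⁻ (live? (toℕ l)) w∈l
          in ∈-comprehension⁺ (live? (toℕ j))
               ( (s , ℕ.≤-trans s≤i (s≤s i≤j) , c)
               , (s′ , s′≤last , ℕ.≤-trans j≤l l≤s′ , c′))
      }
    }

  width≤k+1 : width decomposition ≤ k + 1
  width≤k+1 = PathDecomposition.width≤⁺ decomposition λ i →
    subst (∣ bag i ∣ ∸ 1 ≤_) (ℕ.+-comm 1 k) (ℕ.∸-monoˡ-≤ 1 (∣live∣≤2+k (toℕ i)))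

theorem14 : ∀ (k : ℕ) → 1 ≤ k → ∀ {n} (G : Graph n) →
    TwoLayerPlanar k G → pathwidth G ≤ k + 1
theorem14 k _ G (_ , D , planar , iso) =
  -- Minimality of the pathwidth, applied to the sweep decomposition.
  ℕ.≤-trans (proj₂ (isPathwidth G) (Sweep.decomposition D planar iso)) (Sweep.width≤k+1 D planar iso)
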